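{- Let a monotonic predicate $p$ over input $A$, a monotonic definition $\Sigma^{+}_{\mathbf{p}}$ of the positive predicate atom $\mathbf{p}$, and a lemma of the form $M_A \Rightarrow \overline{\mathbf{p}}$ (with $M_A$ a partial assignment over $A$) be given. Let $X$ be the set of auxiliary variables $var(\Sigma^{+}_{\mathbf{p}}) \setminus (A \cup \{\mathbf{p}\})$. Then the lemma $M_A \Rightarrow \overline{\mathbf{p}}$ is in the theory of $\overline{\mathbf{p}}$ if and only if there exists an assignment $M_X$ on $X$ such that: (1) $\Sigma^{+}_{\mathbf{p}}|_{\overline{\mathbf{p}} \cup M_X \cup M_A}$ is satisfiable, and (2) $\bigl(\Sigma^{+}_{\mathbf{p}}|_{\overline{\mathbf{p}} \cup M_X} \Rightarrow \overline{\mathbf{p}}\bigr) \vdash_{1} (M_A \Rightarrow \overline{\mathbf{p}})$.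
   Context: Basic conventions. A CNF formula is a finite set (conjunction) of clauses; a clause is a disjunction of literals. An assignment (total or partial) is identified with a set of non-conflicting literals. For a formula $F$ and an assignment $M$, $F|_M$ denotes $F$ reduced by $M$: satisfied clauses are removed and falsified literals are discarded from clauses (an empty clause is $\bot$, an empty formula is $\top$). $var(\cdot)$ denotes the set of variables. A clause is Horn if it contains at most one positive literal. An assignment $M_X$ on $X$ assigns a truth value to every variable of $X$. Unit propagation. A unit clause is a clause with one literal. The unit clause rule replaces $F$ by $F|_L$, where $L$ is the set of literals occurring in unit clauses of $F$; unit propagation is the repeated application of this rule until a fixpoint. For a clause $C$, its negation $\overline{C}$ is a set of unit clauses, and $F \vdash_{1} C$ means that unit propagation on $F \wedge \overline{C}$ derives a conflict. Monotonic predicates. Throughout, "monotonic predicate" means positive monotonic predicate: $p:\{0,1\}^n\to\{0,1\}$ over Boolean arguments $A=\{a_1,\dots,a_n\}$ with $p(\dots,a_{i-1},0,a_{i+1},\dots) \implies p(\dots,a_{i-1},1,a_{i+1},\dots)$ for every $i$. The predicate atom $\mathbf{p}$ is a Boolean variable (not in $A$) indicating whether $p(A)$ is true; $\overline{\mathbf{p}}$ is its negation. The theory of $\overline{\mathbf{p}}$ is the set of valid implications $M_A \Rightarrow \overline{\mathbf{p}}$ with $M_A$ a partial assignment over $A$; valid means that $p(M)=\bot$ for every complete assignment $M$ of $A$ extending $M_A$. As a clause, $M_A \Rightarrow \overline{\mathbf{p}}$ consists of the negations of the literals of $M_A$ together with $\overline{\mathbf{p}}$. Propositional definition. A propositional definition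 of $\mathbf{p}$ is a CNF formula $\Sigma_{\mathbf{p}}$ over variables $V \supseteq \{\mathbf{p}\}\cup A$ such that for every truth assignment $M$ to the variables in $A$: (1) $\Sigma_{\mathbf{p}}|_{M}$ is satisfiable, and (2) $\Sigma_{\mathbf{p}} \models (M \Rightarrow \mathbf{p})$ if and only if $p(M)$ is $\top$. Monotonic definition. A monotonic definition $\Sigma^{+}_{\mathbf{p}}$ of $\mathbf{p}$ is a propositional definition of $\mathbf{p}$ such that (1) it contains no positive atoms (positive literals) from $A$, (2) it does not contain the literal $\overline{\mathbf{p}}$, and (3) $\mathbf{p}$ appears only in Horn clauses. CNF encoding of the implication. Given a CNF formula $F=\{C_1,\dots,C_n\}$, the formula $F \Rightarrow \overline{\mathbf{p}}$ is encoded in CNF as follows: introduce a new variable $l_i$ for each clause $C_i$, add the clause $\overline{c_{ij}} \vee \overline{l_i}$ for each literal $c_{ij}\in C_i$, and add the clause $l_1\vee l_2\vee\dots\vee l_n\vee\overline{\mathbf{p}}$. The relation $\vdash_1$ in the claim is with respect to this encoding. -}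

module Defs where

open import Data.Bool.Base using (Bool; true; false; not; if_then_else_)
open import Data.Fin.Base using (Fin)
open import Data.List.Base using (List; []; _∷_; [_]; _++_; map; filter; concatMap; concat; tabulate; length; lookup; allFin; deduplicate)
open import Data.List.Membership.Propositional using (_∈_; _∉_)
import Data.List.Membership.DecPropositional as DecMembership
import Data.List.Relation.Binary.Subset.DecPropositional as DecSubset
open import Data.List.Relation.Binary.Subset.Propositional using (_⊆_)
open import Data.List.Relation.Unary.All using (All; all?)
open import Data.List.Relation.Unary.Any using (Any; any?)
open import Data.Nat.Base using (ℕ)
open import Data.Product.Base using (∃-syntax; _×_)
open import Data.Fin.Properties using () renaming (_≟_ to _≟ᶠ_)
open import Data.Sum.Base using (_⊎_; inj₁; inj₂)
open import Data.Sum.Properties using () renaming (≡-dec to ⊎-≡-dec)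
open import Data.Vec.Base as Vec using (Vec; _[_]≔_)
open import Function.Base using (_∘_)
open import Function.Bundles using (_⇔_)
open import Function.Definitions using (Injective)
open import Relation.Binary.Definitions using (DecidableEquality)
open import Relation.Binary.PropositionalEquality using (_≡_; _≢_; refl)
open import Relation.Nullary using (¬_; yes; no; does)
open import Relation.Nullary.Decidable using (¬?; _×-dec_)

data Literal (V : Set) : Set where
  pos neg : V → Literal V

-- Finite sets of literals and of clauses are represented by lists.  Order and
-- multiplicity carry no meaning: `Horn`, `unit` and `distinct` below respect
-- equality of lists as sets.
Clause : Set → Set
Clause V = List (Literal V)

CNF : Set → Set
CNF V = List (Clause V)

module _ {V : Set} where

  var : Literal V → V
  var (pos x) = x
  var (neg x) = x

  negate : Literal V → Literal V
  negate (pos x) = neg x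
  negate (neg x) = pos x

  literal : V → Bool → Literal V
  literal x b = if b then pos x else neg x

  vars : CNF V → List V
  vars = map var ∘ concat

  Horn : Clause V → Set
  Horn C = ∀ {x y} → pos x ∈ C → pos y ∈ C → x ≡ y

  eval : (V → Bool) → Literal V → Bool
  eval τ (pos x) = τ x
  eval τ (neg x) = not (τ x)

  _satisfiesᶜ_ : (V → Bool) → Clause V → Set
  τ satisfiesᶜ C = Any (λ l → eval τ l ≡ true) C

  _satisfies_ : (V → Bool) → CNF V → Set
  τ satisfies F = All (τ satisfiesᶜ_) F

  Satisfiable : CNF V → Set
  Satisfiable F = ∃[ τ ] τ satisfies F

  infix 4 _⊨_
  _⊨_ : CNF V → Clause V → Set
  F ⊨ C = ∀ τ → τ satisfies F → τ satisfiesᶜ C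

  Conflicting : List (Literal V) → Set
  Conflicting M = ∃[ x ] (pos x ∈ M × neg x ∈ M)

  PartialAssignmentOver : (V → Set) → List (Literal V) → Set
  PartialAssignmentOver X M = ¬ Conflicting M × (∀ {x} → x ∈ map var M → X x)

  AssignmentOn : (V → Set) → List (Literal V) → Set
  AssignmentOn X M = ¬ Conflicting M × (∀ {x} → x ∈ map var M ⇔ X x)

  infix 6 _⟹_
  _⟹_ : List (Literal V) → Literal V → Clause V
  M ⟹ l = map negate M ++ [ l ]

  embed : {W : Set} → (V → W) → Literal V → Literal W
  embed f (pos x) = pos (f x)
  embed f (neg x) = neg (f x)

  ≟-Literal : DecidableEquality V → DecidableEquality (Literal V)
  ≟-Literal _≟_ (pos x) (pos y) with x ≟ y
  ... | yes refl = yes refl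
  ... | no x≢y   = no λ { refl → x≢y refl }
  ≟-Literal _≟_ (neg x) (neg y) with x ≟ y
  ... | yes refl = yes refl
  ... | no x≢y   = no λ { refl → x≢y refl }
  ≟-Literal _≟_ (pos _) (neg _) = no λ ()
  ≟-Literal _≟_ (neg _) (pos _) = no λ ()

module Propagation {V : Set} (_≟_ : DecidableEquality V) where

  _≟ˡ_ : DecidableEquality (Literal V)
  _≟ˡ_ = ≟-Literal _≟_

  open DecMembership _≟ˡ_ using (_∈?_)

  infixl 7 _∣_
  _∣_ : CNF V → List (Literal V) → CNF V
  F ∣ M = map (filter (λ l → ¬? (negate l ∈? M)))
              (filter (λ C → ¬? (any? (_∈? M) C)) F)

  unit : Clause V → List (Literal V)
  unit []      = []
  unit (l ∷ C) = if does (all? (_≟ˡ l) C) then [ l ] else []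

  unitLiterals : CNF V → List (Literal V)
  unitLiterals = concatMap unit

  -- Complementary unit clauses must be detected before reducing: reducing by
  -- a conflicting set of literals would delete both of them as satisfied.
  -- No fixpoint has to be reached explicitly, because an empty clause persists
  -- under further reduction.
  data DerivesConflict (F : CNF V) : Set where
    emptyClause        : [] ∈ F → DerivesConflict F
    complementaryUnits : Conflicting (unitLiterals F) → DerivesConflict F
    propagate          : DerivesConflict (F ∣ unitLiterals F) → DerivesConflict F

  infix 4 _⊢₁_
  _⊢₁_ : CNF V → Clause V → Set
  F ⊢₁ C = DerivesConflict (F ++ map ([_] ∘ negate) C)

module Encoding {V : Set} (_≟_ : DecidableEquality V) where

  open DecSubset (≟-Literal _≟_) using (_⊆?_)

  -- One representative of each clause, so that equal clauses (as sets) share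
  -- their fresh variable.
  distinct : CNF V → CNF V
  distinct = deduplicate (λ C D → (C ⊆? D) ×-dec (D ⊆? C))

  -- The fresh variable of the i-th clause is `inj₂ i`.
  encodeList : (F : CNF V) → Literal V → CNF (V ⊎ Fin (length F))
  encodeList F l =
    concatMap (λ i → map (λ c → negate (embed inj₁ c) ∷ neg (inj₂ i) ∷ []) (lookup F i))
              (allFin (length F))
    ++ [ map (pos ∘ inj₂) (allFin (length F)) ++ [ embed inj₁ l ] ]

  encode : (F : CNF V) → Literal V → CNF (V ⊎ Fin (length (distinct F)))
  encode F = encodeList (distinct F)

  infix 4 ⟨_⇒_⟩⊢₁_
  ⟨_⇒_⟩⊢₁_ : CNF V → Literal V → Clause V → Set
  ⟨ F ⇒ l ⟩⊢₁ C = encode F l ⊢₁ map (embed inj₁) C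
    where open Propagation (⊎-≡-dec _≟_ (_≟ᶠ_ {length (distinct F)}))

Monotonic : ∀ {n} → (Vec Bool n → Bool) → Set
Monotonic p = ∀ v i → p (v [ i ]≔ false) ≡ true → p (v [ i ]≔ true) ≡ true

record Atoms (V : Set) (n : ℕ) : Set where
  field
    a           : Fin n → V
    a-injective : Injective _≡_ _≡_ a
    𝐩           : V
    𝐩-fresh     : ∀ i → a i ≢ 𝐩

  A : V → Set
  A x = ∃[ i ] x ≡ a i

  complete : Vec Bool n → List (Literal V)
  complete v = tabulate (λ i → literal (a i) (Vec.lookup v i))

  -- Membership of the lemma M_A ⇒ ¬𝐩 in the theory of ¬𝐩.
  InTheory : (Vec Bool n → Bool) → List (Literal V) → Set
  InTheory p M = ∀ v → M ⊆ complete v → p v ≡ false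

  Auxiliary : CNF V → V → Set
  Auxiliary Σ x = x ∈ vars Σ × ¬ A x × x ≢ 𝐩

module Definition {V : Set} (_≟_ : DecidableEquality V) {n : ℕ} (atoms : Atoms V n) where
  open Propagation _≟_
  open Atoms atoms

  record IsPropositionalDefinition (p : Vec Bool n → Bool) (Σ : CNF V) : Set where
    field
      satisfiable : ∀ v → Satisfiable (Σ ∣ complete v)
      defines     : ∀ v → (Σ ⊨ complete v ⟹ pos 𝐩) ⇔ p v ≡ true

  record IsMonotonicDefinition (p : Vec Bool n → Bool) (Σ : CNF V) : Set where
    field
      isPropositionalDefinition : IsPropositionalDefinition p Σ
      noPositiveArguments       : ∀ {C} → C ∈ Σ → ∀ i → pos (a i) ∉ C
      noNegative𝐩               : ∀ {C} → C ∈ Σ → neg 𝐩 ∉ C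
      𝐩-onlyInHorn              : ∀ {C} → C ∈ Σ → 𝐩 ∈ map var C → Horn C

    open IsPropositionalDefinition isPropositionalDefinition public

{-# OPTIONS --safe #-}
module Submission where

-- If the lemma is in the theory, extend M-A to the input v that makes every
-- unassigned atom true.  Then p v is false, so Σ⁺ has a model τ extending v with
-- 𝐩 false, found by a finite search over the variables of Σ⁺; let M-X be τ
-- restricted to the auxiliary variables.  Reducing by ¬𝐩 and M-X leaves only
-- negated inputs, and one of them in each clause is true under τ, hence in M-A by
-- the choice of v.  Unit propagation therefore falsifies every fresh variable and
-- then the clause l₁ ∨ … ∨ lₙ ∨ ¬𝐩.
--
-- Conversely unit propagation is sound, so the reduced formula holds whenever M-A
-- and 𝐩 do.  It does not mention 𝐩, so for an input v ⊇ M-A the assignment v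
-- joined with M-X and ¬𝐩 is a model of Σ⁺, and p v must be false.

open import Data.Bool.Base using (Bool; true; false; not; if_then_else_)
open import Data.Bool.Properties using (¬-not; not-involutive) renaming (_≟_ to _≟ᵇ_)
open import Data.Fin.Base using (Fin)
open import Data.Fin.Properties using () renaming (_≟_ to _≟ᶠ_; any? to anyFin?)
open import Data.List.Base
  using (List; []; _∷_; [_]; _++_; map; filter; tabulate; length; lookup; allFin)
import Data.List.Membership.DecPropositional as DecMembership
open import Data.List.Membership.Propositional using (_∈_; _∉_; find; lose)
open import Data.List.Membership.Propositional.Properties
  using (∈-map⁺; ∈-map⁻; ∈-++⁺ˡ; ∈-++⁺ʳ; ∈-filter⁺; ∈-filter⁻;
        ∈-concatMap⁺; ∈-concat⁺′; ∈-tabulate⁺; ∈-lookup; ∈-allFin)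
open import Data.List.Properties using (filter-none; filter-accept; filter-reject)
import Data.List.Relation.Binary.Subset.DecPropositional as DecSubset
open import Data.List.Relation.Binary.Subset.Propositional using (_⊆_)
open import Data.List.Relation.Unary.All as All using (All; []; _∷_; all?)
import Data.List.Relation.Unary.All.Properties as Allₚ
open import Data.List.Relation.Unary.Any as Any using (Any; here; there; any?)
import Data.List.Relation.Unary.Any.Properties as Anyₚ
open import Data.Nat.Base using (ℕ)
open import Data.Product.Base using (∃-syntax; _×_; _,_; proj₁; proj₂)
open import Data.Sum.Base using (_⊎_; inj₁; inj₂) renaming ([_,_] to either)
open import Data.Sum.Properties using () renaming (≡-dec to ⊎-≡-dec)
open import Data.Vec.Base as Vec using (Vec)
open import Data.Vec.Properties using (lookup∘tabulate)
open import Function.Base using (_∘_; case_of_)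
open import Function.Bundles using (_⇔_; mk⇔; Equivalence)
open import Relation.Binary.Definitions using (DecidableEquality)
open import Relation.Binary.PropositionalEquality using (_≡_; _≢_; refl; sym; trans; cong; subst)
open import Relation.Nullary using (¬_; Dec; yes; no; does; contradiction)
open import Relation.Nullary.Decidable using (map′; ¬?; _×-dec_; decidable-stable; dec-true; dec-false)
open import Relation.Unary using (Decidable)
open import Defs

-- Literals, clauses and their truth values under an assignment.

module _ {V : Set} where

  True : (V → Bool) → Literal V → Set
  True τ l = eval τ l ≡ true

  satisfiesᶜ? : ∀ (τ : V → Bool) C → Dec (τ satisfiesᶜ C)
  satisfiesᶜ? τ = any? (λ l → eval τ l ≟ᵇ true)

  satisfies? : ∀ (τ : V → Bool) F → Dec (τ satisfies F)
  satisfies? τ = all? (satisfiesᶜ? τ)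

  var-negate : ∀ (l : Literal V) → var (negate l) ≡ var l
  var-negate (pos _) = refl
  var-negate (neg _) = refl

  negate-involutive : ∀ (l : Literal V) → negate (negate l) ≡ l
  negate-involutive (pos _) = refl
  negate-involutive (neg _) = refl

  var-literal : ∀ (x : V) b → var (literal x b) ≡ x
  var-literal x true  = refl
  var-literal x false = refl

  eval-negate : ∀ (τ : V → Bool) l → eval τ (negate l) ≡ not (eval τ l)
  eval-negate τ (pos x) = refl
  eval-negate τ (neg x) = sym (not-involutive (τ x))

  eval-literal : ∀ (τ : V → Bool) {x b} → τ x ≡ b → True τ (literal x b)
  eval-literal τ {b = true}  eq = eq
  eval-literal τ {b = false} eq = cong not eq

  eval-literal⁻ : ∀ (τ : V → Bool) x b → True τ (literal x b) → τ x ≡ b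
  eval-literal⁻ τ x true  eq = eq
  eval-literal⁻ τ x false eq = ¬-not λ eq′ → case trans (sym eq) (cong not eq′) of λ ()

  eval-cong : ∀ {τ σ : V → Bool} l → τ (var l) ≡ σ (var l) → eval τ l ≡ eval σ l
  eval-cong (pos x) eq = eq
  eval-cong (neg x) eq = cong not eq

  True-consistent : ∀ (τ : V → Bool) l → True τ l → ¬ True τ (negate l)
  True-consistent τ l t f = case trans (sym f) (trans (eval-negate τ l) (cong not t)) of λ ()

  ¬True⇒True-negate : ∀ (τ : V → Bool) l → ¬ True τ l → True τ (negate l)
  ¬True⇒True-negate τ l ¬t = trans (eval-negate τ l) (cong not (¬-not ¬t))

  conflicting : ∀ {M : List (Literal V)} l → l ∈ M → negate l ∈ M → Conflicting M
  conflicting (pos x) p n = x , p , n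
  conflicting (neg x) n p = x , p , n

  True⇒¬Conflicting : ∀ {τ : V → Bool} {M} → All (True τ) M → ¬ Conflicting M
  True⇒¬Conflicting {τ} ts (x , p , n) = True-consistent τ (pos x) (All.lookup ts p) (All.lookup ts n)

  var∈⇒literal∈ : ∀ {M : List (Literal V)} l → var l ∈ map var M → l ∈ M ⊎ negate l ∈ M
  var∈⇒literal∈ l v∈ with ∈-map⁻ var v∈
  var∈⇒literal∈ (pos x) _ | pos _ , m , refl = inj₁ m
  var∈⇒literal∈ (pos x) _ | neg _ , m , refl = inj₂ m
  var∈⇒literal∈ (neg x) _ | pos _ , m , refl = inj₂ m
  var∈⇒literal∈ (neg x) _ | neg _ , m , refl = inj₁ m

  var∈vars : ∀ {F : CNF V} {C l} → C ∈ F → l ∈ C → var l ∈ vars F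
  var∈vars C∈F l∈C = ∈-map⁺ var (∈-concat⁺′ l∈C C∈F)

  ⟹-unsatisfied⁺ : ∀ {τ : V → Bool} {M l} → All (True τ) M → ¬ True τ l → ¬ τ satisfiesᶜ (M ⟹ l)
  ⟹-unsatisfied⁺ {τ} {M} ts ¬t s with Anyₚ.++⁻ (map negate M) s
  ... | inj₂ (here t) = ¬t t
  ... | inj₁ s′ with find (Anyₚ.map⁻ s′)
  ...   | m , m∈ , f = True-consistent τ m (All.lookup ts m∈) f

  ⟹-unsatisfied⁻ : ∀ {τ : V → Bool} {M l} → ¬ τ satisfiesᶜ (M ⟹ l) → All (True τ) M × ¬ True τ l
  ⟹-unsatisfied⁻ {τ} {M} {l} ¬s =
    All.tabulate (λ {m} m∈ → decidable-stable (eval τ m ≟ᵇ true) λ ¬t →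
      ¬s (Anyₚ.++⁺ˡ (Anyₚ.map⁺ (lose m∈ (¬True⇒True-negate τ m ¬t))))) ,
    λ t → ¬s (Anyₚ.++⁺ʳ (map negate M) (here t))

module _ {V W : Set} where

  embed-negate : ∀ (f : V → W) l → embed f (negate l) ≡ negate (embed f l)
  embed-negate f (pos _) = refl
  embed-negate f (neg _) = refl

  var-embed : ∀ (f : V → W) l → var (embed f l) ≡ f (var l)
  var-embed f (pos _) = refl
  var-embed f (neg _) = refl

  eval-embed : ∀ (σ : W → Bool) (f : V → W) l → eval σ (embed f l) ≡ eval (σ ∘ f) l
  eval-embed σ f (pos _) = refl
  eval-embed σ f (neg _) = refl

-- Exhaustive search for assignments over finitely many variables.

module Search {V : Set} (_≟_ : DecidableEquality V) where

  update : (V → Bool) → V → Bool → V → Bool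
  update τ x b y = if does (y ≟ x) then b else τ y

  update-≡ : ∀ τ x b → update τ x b x ≡ b
  update-≡ τ x b rewrite dec-true (x ≟ x) refl = refl

  update-≢ : ∀ τ {x} b {y} → y ≢ x → update τ x b y ≡ τ y
  update-≢ τ {x} b {y} y≢x rewrite dec-false (y ≟ x) y≢x = refl

  -- `V` may be infinite, but by the extensionality hypothesis `P` depends only on the values on
  -- `xs`. Branching on both values of each listed variable therefore exhausts all cases.
  search : ∀ {P : (V → Bool) → Set} → Decidable P → (xs : List V) →
           (∀ {τ σ} → (∀ {x} → x ∈ xs → τ x ≡ σ x) → P τ → P σ) → Dec (∃[ τ ] P τ)
  -- With no relevant variable left all assignments are equivalent, so the constant `false` is an
  -- arbitrary representative.
  search P? [] ext = map′ (_ ,_) (λ (_ , p) → ext (λ ()) p) (P? (λ _ → false))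
  search {P} P? (x ∷ xs) ext
    with branch true | branch false
    where
    branch : ∀ b → Dec (∃[ τ ] P (update τ x b))
    branch b = search (λ τ → P? (update τ x b)) xs λ agree → ext (agree′ agree)
      where
      agree′ : ∀ {τ σ} → (∀ {y} → y ∈ xs → τ y ≡ σ y) →
               ∀ {y} → y ∈ x ∷ xs → update τ x b y ≡ update σ x b y
      agree′ agree {y} y∈ with y ≟ x | y∈
      ... | yes _  | _         = refl
      ... | no y≢x | here y≡x  = contradiction y≡x y≢x
      ... | no _   | there y∈′ = agree y∈′
  ... | yes (τ , p) | _           = yes (_ , p)
  ... | no _        | yes (τ , p) = yes (_ , p)
  -- Any witness `τ` agrees pointwise with its own update at `x` by `τ x`; `ext` carries `P` across,
  -- and the value `τ x` selects the branch that failed.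
  ... | no ¬p       | no ¬q       = no λ (τ , p) →
    split (τ x) τ (ext (λ {y} _ → sym (update-self τ y)) p)
    where
    update-self : ∀ τ y → update τ x (τ x) y ≡ τ y
    update-self τ y with y ≟ x
    ... | yes refl = refl
    ... | no _     = refl
    split : ∀ b τ → ¬ P (update τ x b)
    split true  τ p = ¬p (τ , p)
    split false τ p = ¬q (τ , p)

  satisfiesᶜ-cong : ∀ {τ σ : V → Bool} C → (∀ {x} → x ∈ map var C → τ x ≡ σ x) →
                    τ satisfiesᶜ C → σ satisfiesᶜ C
  satisfiesᶜ-cong C agree s with find s
  ... | l , l∈ , t = lose l∈ (trans (sym (eval-cong l (agree (∈-map⁺ var l∈)))) t)

  satisfies-cong : ∀ {τ σ : V → Bool} F → (∀ {x} → x ∈ vars F → τ x ≡ σ x) →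
                   τ satisfies F → σ satisfies F
  satisfies-cong F agree s = All.tabulate λ {C} C∈ → satisfiesᶜ-cong C
    (λ x∈ → case ∈-map⁻ var x∈ of λ { (l , l∈ , refl) → agree (var∈vars {l = l} C∈ l∈) }) (All.lookup s C∈)

  -- Being a countermodel depends only on the variables of `C ∷ F`, so its existence is decidable
  -- and the double negation can be removed constructively.
  countermodel : ∀ {F : CNF V} {C} → ¬ F ⊨ C → ∃[ τ ] (τ satisfies F × ¬ τ satisfiesᶜ C)
  countermodel {F} {C} ¬⊨ = decidable-stable
    (search (λ τ → satisfies? τ F ×-dec ¬? (satisfiesᶜ? τ C)) (vars (C ∷ F))
      λ agree (s , ¬c) →
        satisfies-cong F (λ x∈ → agree (vars-there x∈)) s ,
        λ c → ¬c (satisfiesᶜ-cong C (λ x∈ → sym (agree (vars-here x∈))) c))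
    λ ¬∃ → ¬⊨ λ τ s → decidable-stable (satisfiesᶜ? τ C) λ ¬c → ¬∃ (τ , s , ¬c)
    where
    vars-there : ∀ {x} → x ∈ vars F → x ∈ vars (C ∷ F)
    vars-there x∈ = case ∈-map⁻ var x∈ of λ { (l , l∈ , refl) → ∈-map⁺ var (∈-++⁺ʳ C l∈) }
    vars-here : ∀ {x} → x ∈ map var C → x ∈ vars (C ∷ F)
    vars-here x∈ = case ∈-map⁻ var x∈ of λ { (l , l∈ , refl) → ∈-map⁺ var (∈-++⁺ˡ l∈) }

-- Reduction by a set of literals and soundness of unit propagation.

module PropagationProperties {V : Set} (_≟_ : DecidableEquality V) where

  open Propagation _≟_
  open DecMembership _≟ˡ_ using (_∈?_)

  conflicting? : ∀ (M : List (Literal V)) → Dec (Conflicting M)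
  conflicting? M = map′
    (λ c → case find c of λ (l , l∈ , n∈) → conflicting l l∈ n∈)
    (λ (x , p , n) → lose p n)
    (any? (λ l → negate l ∈? M) M)

  reduceᶜ : List (Literal V) → Clause V → Clause V
  reduceᶜ M = filter (λ l → ¬? (negate l ∈? M))

  ∈-∣⁺ : ∀ {F C M} → C ∈ F → ¬ Any (_∈ M) C → reduceᶜ M C ∈ F ∣ M
  ∈-∣⁺ {M = M} C∈F ¬sat = ∈-map⁺ (reduceᶜ M) (∈-filter⁺ (λ C → ¬? (any? (_∈? M) C)) C∈F ¬sat)

  ∈-∣⁻ : ∀ {F D M} → D ∈ F ∣ M → ∃[ C ] (C ∈ F × ¬ Any (_∈ M) C × D ≡ reduceᶜ M C)
  ∈-∣⁻ {F} {M = M} D∈ with ∈-map⁻ (reduceᶜ M) D∈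
  ... | C , C∈ , eq with ∈-filter⁻ (λ C → ¬? (any? (_∈? M) C)) {xs = F} C∈
  ...   | C∈F , ¬sat = C , C∈F , ¬sat , eq

  ∈-reduceᶜ⁻ : ∀ {M l} C → l ∈ reduceᶜ M C → l ∈ C × negate l ∉ M
  ∈-reduceᶜ⁻ {M} C = ∈-filter⁻ (λ l → ¬? (negate l ∈? M)) {xs = C}

  ∈-∣⇒negate∉ : ∀ {F D M l} → D ∈ F ∣ M → l ∈ D → negate l ∉ M
  ∈-∣⇒negate∉ {F} {l = l} D∈ l∈D = case ∈-∣⁻ {F = F} D∈ of λ where
    (C , _ , _ , D≡) → proj₂ (∈-reduceᶜ⁻ C (subst (l ∈_) D≡ l∈D))

  -- A literal true under `τ` is never discarded, since its negation would have to be among the true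
  -- literals `M`.
  satisfies-∣⁺ : ∀ {τ F M} → All (True τ) M → τ satisfies F → τ satisfies (F ∣ M)
  satisfies-∣⁺ {τ} {F} {M} ts s = All.tabulate λ D∈ → case ∈-∣⁻ {F = F} D∈ of λ where
    (C , C∈F , _ , refl) → case find (All.lookup s C∈F) of λ (l , l∈C , t) →
      lose (∈-filter⁺ (λ l → ¬? (negate l ∈? M)) l∈C λ n∈ → True-consistent τ l t (All.lookup ts n∈)) t

  satisfies-∣⁻ : ∀ {τ F M} → All (True τ) M → τ satisfies (F ∣ M) → τ satisfies F
  satisfies-∣⁻ {τ} {F} {M} ts s = All.tabulate λ {C} C∈F → case any? (_∈? M) C of λ where
    (yes sat) → Any.map (All.lookup ts) sat
    (no ¬sat) → case find (All.lookup s (∈-∣⁺ C∈F ¬sat)) of λ (l , l∈ , t) →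
      lose (proj₁ (∈-reduceᶜ⁻ C l∈)) t

  ∈-unitLiterals⁺ : ∀ {F l} → [ l ] ∈ F → l ∈ unitLiterals F
  ∈-unitLiterals⁺ u∈ = ∈-concatMap⁺ unit (lose u∈ (here refl))

  -- The clause found may repeat `l`, because `unit` treats clauses as sets; hence the conclusion is
  -- weaker than `C ≡ [ l ]`.
  ∈-unitLiterals⁻ : ∀ {F l} → l ∈ unitLiterals F → ∃[ C ] (C ∈ F × l ∈ C × All (_≡ l) C)
  ∈-unitLiterals⁻ {F} l∈ with find (Anyₚ.concatMap⁻ unit {xs = F} l∈)
  ... | k ∷ C , C∈F , u∈ with all? (_≟ˡ k) C
  ∈-unitLiterals⁻ l∈ | k ∷ C , C∈F , here refl | yes all = k ∷ C , C∈F , here refl , refl ∷ all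

  unitLiterals-True : ∀ {τ F} → τ satisfies F → All (True τ) (unitLiterals F)
  unitLiterals-True {τ} s = All.tabulate λ l∈ → case ∈-unitLiterals⁻ l∈ of λ (C , C∈F , _ , all) →
    case All.lookupAny all (All.lookup s C∈F) of λ (eq , t) → subst (True τ) eq t

  -- Every model makes all unit literals true, so it remains a model after each round of reduction,
  -- and neither kind of conflict admits a model.
  DerivesConflict-sound : ∀ {τ F} → τ satisfies F → ¬ DerivesConflict F
  DerivesConflict-sound s (emptyClause e)        = case All.lookup s e of λ ()
  DerivesConflict-sound s (complementaryUnits c) = True⇒¬Conflicting (unitLiterals-True s) c
  DerivesConflict-sound s (propagate d)          =
    DerivesConflict-sound (satisfies-∣⁺ (unitLiterals-True s) s) d

  ⊢₁-sound : ∀ {F C} → F ⊢₁ C → F ⊨ C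
  ⊢₁-sound {F} {C} d τ s = decidable-stable (satisfiesᶜ? τ C) λ ¬c →
    DerivesConflict-sound
      (Allₚ.++⁺ s (Allₚ.map⁺ (All.map (λ {l} ¬t → here (¬True⇒True-negate τ l ¬t)) (Allₚ.¬Any⇒All¬ C ¬c)))) d

-- The CNF encoding of an implication and propagation on it.

module EncodingProperties {V : Set} (_≟_ : DecidableEquality V) where

  open Encoding _≟_
  open DecSubset (≟-Literal _≟_) using (_⊆?_)

  -- Each dropped clause has the same literals as a retained one, and satisfaction depends only on
  -- that set.
  distinct-satisfies⁻ : ∀ {τ F} → τ satisfies distinct F → τ satisfies F
  distinct-satisfies⁻ {τ} {F} = Allₚ.deduplicate⁻ (λ C D → (C ⊆? D) ×-dec (D ⊆? C))
    (λ (C⊆D , _) s → case find s of λ (l , l∈ , t) → lose (C⊆D l∈) t) F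

  distinct-All⁺ : ∀ {P : Clause V → Set} {F} → All P F → All P (distinct F)
  distinct-All⁺ = Allₚ.deduplicate⁺ (λ C D → (C ⊆? D) ×-dec (D ⊆? C))

  module _ (G : CNF V) (l : Literal V) where

    private
      W : Set
      W = V ⊎ Fin (length G)

    open Propagation (⊎-≡-dec _≟_ (_≟ᶠ_ {length G}))
    open PropagationProperties (⊎-≡-dec _≟_ (_≟ᶠ_ {length G}))
    open DecMembership (≟-Literal (⊎-≡-dec _≟_ (_≟ᶠ_ {length G}))) using (_∈?_)

    implicationClause : Fin (length G) → Literal V → Clause W
    implicationClause i c = negate (embed inj₁ c) ∷ neg (inj₂ i) ∷ []

    disjunctionClause : Clause W
    disjunctionClause = map (pos ∘ inj₂) (allFin (length G)) ++ [ embed inj₁ l ]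

    encodeList-All : ∀ {P : Clause W → Set} →
      (∀ i {c} → c ∈ lookup G i → P (implicationClause i c)) →
      P disjunctionClause → All P (encodeList G l)
    encodeList-All imp dis = Allₚ.++⁺
      (Allₚ.concat⁺ (Allₚ.map⁺ (All.universal (λ i → Allₚ.map⁺ (All.tabulate (imp i))) (allFin (length G)))))
      (dis ∷ [])

    implicationClause∈ : ∀ i {c} → c ∈ lookup G i → implicationClause i c ∈ encodeList G l
    implicationClause∈ i c∈ = ∈-++⁺ˡ (∈-concatMap⁺ (λ i → map (implicationClause i) (lookup G i))
      (lose (∈-allFin i) (∈-map⁺ (implicationClause i) c∈)))

    disjunctionClause∈ : disjunctionClause ∈ encodeList G l
    disjunctionClause∈ = ∈-++⁺ʳ _ (here refl)

    -- The intended reading of a fresh variable: it asserts that its clause is falsified. This makes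
    -- the implication clauses hold under any `τ`.
    extend : (V → Bool) → W → Bool
    extend τ = either τ λ i → not (does (satisfiesᶜ? τ (lookup G i)))

    encodeList-satisfies : ∀ τ → ¬ τ satisfies G → extend τ satisfies encodeList G l
    encodeList-satisfies τ ¬s = encodeList-All imp (Anyₚ.++⁺ˡ (Anyₚ.map⁺ dis))
      where
      σ : W → Bool
      σ = extend τ
      imp : ∀ i {c} → c ∈ lookup G i → σ satisfiesᶜ implicationClause i c
      imp i {c} c∈ with eval τ c ≟ᵇ true
      ... | yes t = there (here (trans (not-involutive _) (dec-true (satisfiesᶜ? τ (lookup G i)) (lose c∈ t))))
      ... | no ¬t = here (¬True⇒True-negate σ (embed inj₁ c) (¬t ∘ trans (sym (eval-embed σ inj₁ c))))
      false∈ : Any (λ C → ¬ τ satisfiesᶜ C) G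
      false∈ = Allₚ.¬All⇒Any¬ (satisfiesᶜ? τ) G ¬s
      dis : Any (λ i → True σ (pos (inj₂ i))) (allFin (length G))
      dis = lose (∈-allFin (Any.index false∈))
        (cong not (dec-false (satisfiesᶜ? τ _) (Anyₚ.lookup-index false∈)))

    -- If `τ` falsified a clause of `G`, then `extend τ` would model the encoding, and soundness of
    -- propagation would make `M ⟹ l` true under `τ`.
    encodeList-sound : ∀ {M} → encodeList G l ⊢₁ map (embed inj₁) (M ⟹ l) →
      ∀ {τ} → All (True τ) M → ¬ True τ l → τ satisfies G
    encodeList-sound d {τ} ts ¬t = decidable-stable (satisfies? τ G) λ ¬s →
      ⟹-unsatisfied⁺ ts ¬t
        (Any.map (λ {c} → trans (sym (eval-embed _ inj₁ c)))
          (Anyₚ.map⁻ (⊢₁-sound d _ (encodeList-satisfies τ ¬s))))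

    refutationQuery : List (Literal V) → CNF W
    refutationQuery M = encodeList G l ++ map ([_] ∘ negate) (map (embed inj₁) (M ⟹ l))

    -- One round of propagation derives the negations of all fresh variables, and a
    -- second one empties the disjunction.
    encodeList-complete : ∀ {M} → All (Any (_∈ M)) G →
      encodeList G l ⊢₁ map (embed inj₁) (M ⟹ l)
    encodeList-complete {M} hits with conflicting? (unitLiterals (refutationQuery M))
    -- This case does occur: for empty `G` the disjunction is itself the unit clause of `l`, against
    -- the negated goal.
    ... | yes c = complementaryUnits c
    -- Consistency of `L₀` protects the clauses used below from deletion: the old literals in them
    -- are complements of unit literals.
    ... | no ¬c₀ = propagate round₂
      where
      F₀ : CNF W
      F₀ = refutationQuery M
      L₀ : List (Literal W)
      L₀ = unitLiterals F₀
      F₁ : CNF W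
      F₁ = F₀ ∣ L₀
      L₁ : List (Literal W)
      L₁ = unitLiterals F₁

      goal∈L₀ : ∀ {k} → k ∈ M ⟹ l → negate (embed inj₁ k) ∈ L₀
      goal∈L₀ k∈ = ∈-unitLiterals⁺ (∈-++⁺ʳ (encodeList G l) (∈-map⁺ ([_] ∘ negate) (∈-map⁺ (embed inj₁) k∈)))

      M∈L₀ : ∀ {m} → m ∈ M → embed inj₁ m ∈ L₀
      M∈L₀ {m} m∈ = subst (_∈ L₀)
        (trans (cong negate (embed-negate inj₁ m)) (negate-involutive (embed inj₁ m)))
        (goal∈L₀ (∈-++⁺ˡ (∈-map⁺ negate m∈)))

      l∈L₀ : negate (embed inj₁ l) ∈ L₀
      l∈L₀ = goal∈L₀ (∈-++⁺ʳ (map negate M) (here refl))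

      OldLiteral : Literal W → Set
      OldLiteral k = ∃[ x ] var k ≡ inj₁ x

      -- Since every clause contains an old literal, no unit clause consists of a fresh one, so the
      -- first round leaves all fresh literals in place.
      old : All (Any OldLiteral) F₀
      old = Allₚ.++⁺
        (encodeList-All
          (λ i {c} _ → here (var c , trans (var-negate (embed inj₁ c)) (var-embed inj₁ c)))
          (Anyₚ.++⁺ʳ (map (pos ∘ inj₂) (allFin (length G))) (here (var l , var-embed inj₁ l))))
        (Allₚ.map⁺ (Allₚ.map⁺ (All.universal
          (λ c → here (var c , trans (var-negate (embed inj₁ c)) (var-embed inj₁ c))) (M ⟹ l))))

      fresh∉L₀ : ∀ {k i} → var k ≡ inj₂ i → k ∉ L₀
      fresh∉L₀ eq k∈ with ∈-unitLiterals⁻ k∈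
      ... | C , C∈ , _ , all with All.lookupAny all (All.lookup old C∈)
      ...   | refl , x , eq′ = case trans (sym eq) eq′ of λ ()

      -- The literal `c` shared by clause `i` and `M` is a unit of the negated goal; its complement
      -- is discarded, which leaves a unit clause.
      fresh∈L₁ : ∀ i → neg (inj₂ i) ∈ L₁
      fresh∈L₁ i with find (All.lookup hits (∈-lookup i))
      ... | c , c∈C , c∈M = ∈-unitLiterals⁺ (subst (_∈ F₁) reduced
              (∈-∣⁺ (∈-++⁺ˡ (implicationClause∈ i c∈C)) unsat))
        where
        unsat : ¬ Any (_∈ L₀) (implicationClause i c)
        unsat (here n∈)         = ¬c₀ (conflicting (embed inj₁ c) (M∈L₀ c∈M) n∈)
        unsat (there (here n∈)) = fresh∉L₀ refl n∈
        reduced : reduceᶜ L₀ (implicationClause i c) ≡ [ neg (inj₂ i) ]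
        reduced = trans
          (filter-reject (λ k → ¬? (negate k ∈? L₀)) λ ∉ →
            ∉ (subst (_∈ L₀) (sym (negate-involutive (embed inj₁ c))) (M∈L₀ c∈M)))
          (filter-accept (λ k → ¬? (negate k ∈? L₀)) (fresh∉L₀ refl))

      D : Clause W
      D = reduceᶜ L₀ disjunctionClause

      D∈F₁ : D ∈ F₁
      D∈F₁ = ∈-∣⁺ (∈-++⁺ˡ disjunctionClause∈) unsat
        where
        unsat : ¬ Any (_∈ L₀) disjunctionClause
        unsat s with Anyₚ.++⁻ (map (pos ∘ inj₂) (allFin (length G))) s
        ... | inj₂ (here l∈) = ¬c₀ (conflicting (embed inj₁ l) l∈ l∈L₀)
        ... | inj₁ s′ with find (Anyₚ.map⁻ s′)
        ...   | i , _ , i∈ = fresh∉L₀ refl i∈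

      D-falsified : ∀ {k} → k ∈ D → negate k ∈ L₁
      D-falsified k∈ with ∈-reduceᶜ⁻ disjunctionClause k∈
      ... | k∈B , ¬n with Anyₚ.++⁻ (map (pos ∘ inj₂) (allFin (length G))) k∈B
      ...   | inj₂ (here refl) = contradiction l∈L₀ ¬n
      ...   | inj₁ k∈′ with ∈-map⁻ (pos ∘ inj₂) k∈′
      ...     | i , _ , refl = fresh∈L₁ i

      round₂ : DerivesConflict F₁
      round₂ with conflicting? L₁
      ... | yes c  = complementaryUnits c
      -- Consistency of `L₁` keeps `D` from being removed as satisfied, so the second reduction
      -- really yields the empty clause.
      ... | no ¬c₁ = propagate (emptyClause (subst (_∈ F₁ ∣ L₁)
              (filter-none (λ k → ¬? (negate k ∈? L₁)) (All.tabulate λ k∈ ∉ → ∉ (D-falsified k∈)))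
              (∈-∣⁺ D∈F₁ λ s → case find s of λ (k , k∈D , k∈L₁) →
                ¬c₁ (conflicting k k∈L₁ (D-falsified k∈D)))))

-- Monotonic definitions, their reductions, and the two directions of the equivalence.

module MonotonicDefinitionProperties
  {V : Set} (_≟_ : DecidableEquality V) {n : ℕ} (atoms : Atoms V n) where

  open Propagation _≟_
  open PropagationProperties _≟_
  open Encoding _≟_
  open EncodingProperties _≟_
  open Search _≟_
  open Atoms atoms
  open Definition _≟_ atoms
  open DecMembership _≟ˡ_ using (_∈?_)
  open DecMembership _≟_ using () renaming (_∈?_ to _∈ᵛ?_)

  A? : Decidable A
  A? x = anyFin? (λ i → x ≟ a i)

  module _ (M : List (Literal V)) where

    maximalExtension : Vec Bool n
    maximalExtension = Vec.tabulate λ i → not (does (neg (a i) ∈? M))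

    maximalExtension-false : ∀ {i} → neg (a i) ∈ M → Vec.lookup maximalExtension i ≡ false
    maximalExtension-false {i} n∈ = trans (lookup∘tabulate _ i) (cong not (dec-true (neg (a i) ∈? M) n∈))

    maximalExtension-true : ∀ {i} → neg (a i) ∉ M → Vec.lookup maximalExtension i ≡ true
    maximalExtension-true {i} n∉ = trans (lookup∘tabulate _ i) (cong not (dec-false (neg (a i) ∈? M) n∉))

    -- The point of defaulting unassigned inputs to true: only `M` itself can make an input false,
    -- so a true negated input is a member of `M`.
    maximalExtension-false⁻ : ∀ {i} → Vec.lookup maximalExtension i ≡ false → neg (a i) ∈ M
    maximalExtension-false⁻ {i} eq = decidable-stable (neg (a i) ∈? M) λ n∉ →
      case trans (sym eq) (maximalExtension-true n∉) of λ ()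

    ⊆-maximalExtension : PartialAssignmentOver A M → M ⊆ complete maximalExtension
    ⊆-maximalExtension (¬conflict , over) {l} l∈ with over (∈-map⁺ var l∈)
    ... | i , eq = subst (_∈ complete maximalExtension) (literal≡ l eq l∈) (∈-tabulate⁺ i)
      where
      literal≡ : ∀ l → var l ≡ a i → l ∈ M → literal (a i) (Vec.lookup maximalExtension i) ≡ l
      literal≡ (pos _) refl l∈ = cong (literal (a i)) (maximalExtension-true λ n∈ → ¬conflict (a i , l∈ , n∈))
      literal≡ (neg _) refl l∈ = cong (literal (a i)) (maximalExtension-false l∈)

  module _ (F : CNF V) (τ : V → Bool) where

    auxiliary? : Decidable (Auxiliary F)
    auxiliary? x = (x ∈ᵛ? vars F) ×-dec ¬? (A? x) ×-dec ¬? (x ≟ 𝐩)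

    auxiliaryPart : List (Literal V)
    auxiliaryPart = map (λ x → literal x (τ x)) (filter auxiliary? (vars F))

    auxiliaryPart-True : All (True τ) auxiliaryPart
    auxiliaryPart-True = Allₚ.map⁺ (All.universal (λ x → eval-literal τ refl) _)

    auxiliaryPart-AssignmentOn : AssignmentOn (Auxiliary F) auxiliaryPart
    auxiliaryPart-AssignmentOn = True⇒¬Conflicting auxiliaryPart-True , mk⇔ to from
      where
      to : ∀ {x} → x ∈ map var auxiliaryPart → Auxiliary F x
      to x∈ with ∈-map⁻ var x∈
      ... | _ , l∈ , refl with ∈-map⁻ _ l∈
      ...   | y , y∈ , refl = subst (Auxiliary F) (sym (var-literal y (τ y)))
                (proj₂ (∈-filter⁻ auxiliary? {xs = vars F} y∈))
      from : ∀ {x} → Auxiliary F x → x ∈ map var auxiliaryPart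
      from {x} aux = subst (_∈ map var auxiliaryPart) (var-literal x (τ x))
        (∈-map⁺ var (∈-map⁺ (λ x → literal x (τ x)) (∈-filter⁺ auxiliary? (proj₁ aux) aux)))

  -- By cases on the variable. A literal on `𝐩` or on an auxiliary variable is decided by the
  -- reducing assignment, so it either satisfies the clause or is discarded. Only input literals are
  -- left, and these are negative.
  surviving-literal : ∀ {F : CNF V} {M-X : List (Literal V)} {v : Vec Bool n} {τ : V → Bool} {C : Clause V} →
    C ∈ F → (∀ i → pos (a i) ∉ C) →
    AssignmentOn (Auxiliary F) M-X → All (True τ) (complete v) → ¬ Any (_∈ [ neg 𝐩 ] ++ M-X) C →
    ∀ l → l ∈ C → negate l ∉ [ neg 𝐩 ] ++ M-X → True τ l →
    ∃[ i ] (l ≡ neg (a i) × Vec.lookup v i ≡ false)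
  surviving-literal {F} {M-X} {v} {τ} C∈ no⁺ (_ , over) v-true unsat l l∈C n∉ t =
    go l l∈C n∉ t (A? (var l)) (var l ≟ 𝐩)
    where
    go : ∀ l → l ∈ _ → negate l ∉ [ neg 𝐩 ] ++ M-X → True τ l → Dec (A (var l)) → Dec (var l ≡ 𝐩) →
         ∃[ i ] (l ≡ neg (a i) × Vec.lookup v i ≡ false)
    go (pos _) l∈C n∉ t (yes (i , refl)) _ = contradiction l∈C (no⁺ i)
    go (neg _) l∈C n∉ t (yes (i , refl)) _ = i , refl ,
      trans (sym (eval-literal⁻ τ (a i) (Vec.lookup v i) (All.lookup v-true (∈-tabulate⁺ i))))
        (eval-literal⁻ τ (a i) false t)
    go (pos _) l∈C n∉ t (no _) (yes refl) = contradiction (here refl) n∉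
    go (neg _) l∈C n∉ t (no _) (yes refl) = contradiction (lose l∈C (here refl)) unsat
    go l l∈C n∉ t (no ¬A) (no ≢𝐩)
      with var∈⇒literal∈ l (Equivalence.from over (var∈vars {l = l} C∈ l∈C , ¬A , ≢𝐩))
    ... | inj₁ l∈ = contradiction (lose l∈C (there l∈)) unsat
    ... | inj₂ n∈ = contradiction (there n∈) n∉

  reduced-hit : ∀ {F : CNF V} {M-X : List (Literal V)} {v : Vec Bool n} {τ : V → Bool} →
    (∀ {C} → C ∈ F → ∀ i → pos (a i) ∉ C) → AssignmentOn (Auxiliary F) M-X →
    All (True τ) M-X → True τ (neg 𝐩) → All (True τ) (complete v) → τ satisfies F →
    ∀ {D} → D ∈ F ∣ ([ neg 𝐩 ] ++ M-X) →
    ∃[ i ] (neg (a i) ∈ D × Vec.lookup v i ≡ false)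
  reduced-hit {F} {M-X} {v} {τ} no⁺ assignment X-true ¬𝐩-true v-true s {D} D∈ =
    go (∈-∣⁻ {F = F} D∈) (find (All.lookup (satisfies-∣⁺ {F = F} (¬𝐩-true ∷ X-true) s) D∈))
    where
    M : List (Literal V)
    M = [ neg 𝐩 ] ++ M-X
    go : ∃[ C ] (C ∈ F × ¬ Any (_∈ M) C × D ≡ reduceᶜ M C) → ∃[ l ] (l ∈ D × True τ l) →
         ∃[ i ] (neg (a i) ∈ D × Vec.lookup v i ≡ false)
    go (C , C∈ , unsat , D≡) (l , l∈D , t) =
      let l∈C , n∉ = ∈-reduceᶜ⁻ C (subst (l ∈_) D≡ l∈D)
          i , l≡ , eq = surviving-literal {F} {M-X} {v} {τ} C∈ (no⁺ C∈) assignment v-true unsat l l∈C n∉ t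
      in i , subst (_∈ D) l≡ l∈D , eq

  -- Off the inputs, a variable without a positive literal in `M-X` defaults to false; for `𝐩` the
  -- value is overridden in `join`.
  joinInputs : Vec Bool n → List (Literal V) → V → Bool
  joinInputs v M-X x with A? x
  ... | yes (i , _) = Vec.lookup v i
  ... | no _        = does (pos x ∈? M-X)

  joinInputs-a : ∀ v M-X i → joinInputs v M-X (a i) ≡ Vec.lookup v i
  joinInputs-a v M-X i with A? (a i)
  -- The search returns some index `j` with the same atom; injectivity identifies it with `i`.
  ... | yes (j , eq) = cong (Vec.lookup v) (sym (a-injective eq))
  ... | no ¬A        = contradiction (i , refl) ¬A

  joinInputs-¬A : ∀ v M-X {x} → ¬ A x → joinInputs v M-X x ≡ does (pos x ∈? M-X)
  joinInputs-¬A v M-X {x} ¬A with A? x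
  ... | yes Ax = contradiction Ax ¬A
  ... | no _   = refl

  -- The value of `𝐩` is a parameter because the refutation is used with `𝐩` true, whereas the model
  -- of `Σ⁺` needs `𝐩` false.
  join : Vec Bool n → List (Literal V) → Bool → V → Bool
  join v M-X = update (joinInputs v M-X) 𝐩

  join-True-complete : ∀ v M-X b → All (True (join v M-X b)) (complete v)
  join-True-complete v M-X b = Allₚ.tabulate⁺ λ i →
    eval-literal (join v M-X b) (trans (update-≢ (joinInputs v M-X) b (𝐩-fresh i)) (joinInputs-a v M-X i))

  join-True-auxiliary : ∀ {F M-X} v → AssignmentOn (Auxiliary F) M-X → ∀ b → All (True (join v M-X b)) M-X
  join-True-auxiliary {F} {M-X} v (¬conflict , over) b =
    All.tabulate λ {l} l∈ → go l l∈ (Equivalence.to over (∈-map⁺ var l∈))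
    where
    join-aux : ∀ {x} → Auxiliary F x → join v M-X b x ≡ does (pos x ∈? M-X)
    join-aux (_ , ¬A , ≢𝐩) = trans (update-≢ (joinInputs v M-X) b ≢𝐩) (joinInputs-¬A v M-X ¬A)
    go : ∀ l → l ∈ M-X → Auxiliary F (var l) → True (join v M-X b) l
    go (pos x) l∈ aux = trans (join-aux aux) (dec-true (pos x ∈? M-X) l∈)
    go (neg x) l∈ aux = cong not
      (trans (join-aux aux) (dec-false (pos x ∈? M-X) λ p∈ → ¬conflict (x , p∈ , l∈)))

  -- The reduced formula does not contain 𝐩 positively, so 𝐩 may be made false.
  reduced-flip : ∀ {F} v M-X → join v M-X true satisfies (F ∣ ([ neg 𝐩 ] ++ M-X)) →
    join v M-X false satisfies (F ∣ ([ neg 𝐩 ] ++ M-X))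
  reduced-flip {F} v M-X s = All.tabulate λ D∈ → case find (All.lookup s D∈) of λ (l , l∈D , t) →
    lose l∈D (go l (∈-∣⇒negate∉ {F = F} D∈ l∈D) t (var l ≟ 𝐩))
    where
    go : ∀ l → negate l ∉ [ neg 𝐩 ] ++ M-X → True (join v M-X true) l → Dec (var l ≡ 𝐩) →
         True (join v M-X false) l
    go l _ t (no ≢𝐩) = trans
      (eval-cong l (trans (update-≢ (joinInputs v M-X) false ≢𝐩) (sym (update-≢ (joinInputs v M-X) true ≢𝐩)))) t
    go (pos _) n∉ _ (yes refl) = contradiction (here refl) n∉
    go (neg _) _ _ (yes refl) = cong not (update-≡ (joinInputs v M-X) 𝐩 false)

  module _ (p : Vec Bool n → Bool) (Σ⁺ : CNF V) (isDefinition : IsMonotonicDefinition p Σ⁺)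
           (M-A : List (Literal V)) where

    open IsMonotonicDefinition isDefinition

    Certificate : List (Literal V) → Set
    Certificate M-X = AssignmentOn (Auxiliary Σ⁺) M-X
      × Satisfiable (Σ⁺ ∣ ([ neg 𝐩 ] ++ M-X ++ M-A))
      × ⟨ Σ⁺ ∣ ([ neg 𝐩 ] ++ M-X) ⇒ neg 𝐩 ⟩⊢₁ (M-A ⟹ neg 𝐩)

    -- One model serves both conditions: `τ` satisfies the reduced formula, and the negated input it
    -- makes true in each reduced clause lies in `M-A`, as completeness of propagation requires.
    auxiliaryPart-Certificate : ∀ {τ} → PartialAssignmentOver A M-A → τ satisfies Σ⁺ →
      All (True τ) (complete (maximalExtension M-A)) → True τ (neg 𝐩) → Certificate (auxiliaryPart Σ⁺ τ)
    auxiliaryPart-Certificate {τ} partial s v-true ¬𝐩-true = assignment ,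
      (τ , satisfies-∣⁺ (¬𝐩-true ∷ Allₚ.++⁺ X-true (Allₚ.anti-mono (⊆-maximalExtension M-A partial) v-true)) s) ,
      encodeList-complete _ _ (distinct-All⁺ (All.tabulate λ D∈ →
        case reduced-hit {Σ⁺} {auxiliaryPart Σ⁺ τ} {maximalExtension M-A} {τ}
               noPositiveArguments assignment X-true ¬𝐩-true v-true s D∈ of λ (_ , n∈D , eq) →
           lose n∈D (maximalExtension-false⁻ M-A eq)))
      where
      assignment : AssignmentOn (Auxiliary Σ⁺) (auxiliaryPart Σ⁺ τ)
      assignment = auxiliaryPart-AssignmentOn Σ⁺ τ
      X-true : All (True τ) (auxiliaryPart Σ⁺ τ)
      X-true = auxiliaryPart-True Σ⁺ τ

    InTheory⇒Certificate : PartialAssignmentOver A M-A → InTheory p M-A → ∃[ M-X ] Certificate M-X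
    InTheory⇒Certificate partial inTheory =
      -- Entailment would make `p v` true by `defines`, against membership in the theory; the
      -- countermodel then realizes `v` with `𝐩` false.
      let τ , s , ¬c = countermodel {F = Σ⁺} {C = complete v ⟹ pos 𝐩} λ ⊨𝐩 →
            case trans (sym (Equivalence.to (defines v) ⊨𝐩)) (inTheory v (⊆-maximalExtension M-A partial)) of λ ()
          v-true , ¬𝐩 = ⟹-unsatisfied⁻ {τ = τ} {complete v} {pos 𝐩} ¬c
      in auxiliaryPart Σ⁺ τ , auxiliaryPart-Certificate partial s v-true (¬True⇒True-negate τ (pos 𝐩) ¬𝐩)
      where
      v : Vec Bool n
      v = maximalExtension M-A

    Certificate⇒InTheory : ∃[ M-X ] Certificate M-X → InTheory p M-A
    Certificate⇒InTheory (M-X , assignment , _ , refuted) v M-A⊆v = ¬-not λ pv →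
      -- If `p v` held, every model of `Σ⁺` extending `v` would make `𝐩` true; the joined assignment
      -- with `𝐩` false is a model violating this.
      ⟹-unsatisfied⁺ (join-True-complete v M-X false)
        (λ t → case trans (sym t) (update-≡ (joinInputs v M-X) 𝐩 false) of λ ())
        (Equivalence.from (defines v) pv (join v M-X false)
          (satisfies-∣⁻ (cong not (update-≡ (joinInputs v M-X) 𝐩 false) ∷ join-True-auxiliary {Σ⁺} v assignment false)
            (reduced-flip {Σ⁺} v M-X reduced-true)))
      where
      reduced-true : join v M-X true satisfies (Σ⁺ ∣ ([ neg 𝐩 ] ++ M-X))
      -- `𝐩` is set to true here because the clause `M-A ⟹ neg 𝐩` must be falsified before the
      -- refutation says anything about the reduced formula.
      reduced-true = distinct-satisfies⁻ (encodeList-sound _ _ refuted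
        (Allₚ.anti-mono M-A⊆v (join-True-complete v M-X true))
        λ t → True-consistent (join v M-X true) (neg 𝐩) t (update-≡ (joinInputs v M-X) 𝐩 true))

theorem3 : {V : Set} (_≟_ : DecidableEquality V) {n : ℕ} (atoms : Atoms V n) →
    let open Propagation _≟_
        open Encoding _≟_
        open Atoms atoms
        open Definition _≟_ atoms
    in
    (p : Vec Bool n → Bool) → Monotonic p →
    (Σ⁺ : CNF V) → IsMonotonicDefinition p Σ⁺ →
    (M-A : List (Literal V)) → PartialAssignmentOver A M-A →
    InTheory p M-A ⇔
    (∃[ M-X ] (AssignmentOn (Auxiliary Σ⁺) M-X
      × Satisfiable (Σ⁺ ∣ ([ neg 𝐩 ] ++ M-X ++ M-A))
      × ⟨ Σ⁺ ∣ ([ neg 𝐩 ] ++ M-X) ⇒ neg 𝐩 ⟩⊢₁ (M-A ⟹ neg 𝐩)))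
theorem3 _≟_ atoms p _ Σ⁺ isDefinition M-A partial =
  mk⇔ (InTheory⇒Certificate p Σ⁺ isDefinition M-A partial) (Certificate⇒InTheory p Σ⁺ isDefinition M-A)
  where open MonotonicDefinitionProperties _≟_ atoms
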